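{- Let $f \in \mathbb{Z}[x]$ be a polynomial of degree $d$, and let $n$ be any integer with $n > L(f')$, where $f'$ is the derivative of $f$. Then there is a square-free polynomial $g \in \mathbb{Z}[x]$ with $\deg g = n$ such that $L(f-g) = 1$ if $x^2 \nmid f(x)$, and $L(f-g) = 2$ if $x^2 \mid f(x)$. (In particular, in all cases there is such a square-free $g$ of degree $n$ with $L(f-g)\le 2$.)
   Context: For $h(x) = a_n x^n + \cdots + a_0 \in \mathbb{Z}[x]$, its length is $L(h) = |a_n| + |a_{n-1}| + \cdots + |a_0|$ (with $L(0)=0$). A polynomial $g \in \mathbb{Z}[x]$ is called square-free if there is no polynomial $h \in \mathbb{Z}[x]$ of degree at least $1$ such that $h^2$ divides $g$. -}

module Defs where

open import Data.Nat as ℕ using (ℕ; zero; suc)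
open import Data.Integer as ℤ using (ℤ; +_; ∣_∣)
open import Data.List using (List; []; _∷_)
open import Data.Product using (∃; _×_)
open import Relation.Nullary using (¬_)
open import Relation.Binary.PropositionalEquality using (_≡_; _≢_)

-- Integer polynomials as little-endian coefficient lists:
-- a₀ ∷ a₁ ∷ … ∷ aₖ ∷ [] represents a₀ + a₁ x + … + aₖ xᵏ.
-- Trailing zeros are allowed; all notions below only depend on the
-- coefficient function, so they are invariant under trailing zeros.
Poly : Set
Poly = List ℤ

coeff : Poly → ℕ → ℤ
coeff []       _       = + 0
coeff (a ∷ _)  zero    = a
coeff (_ ∷ as) (suc k) = coeff as k

infix 4 _≈ₚ_
_≈ₚ_ : Poly → Poly → Set
p ≈ₚ q = ∀ k → coeff p k ≡ coeff q k

infixl 6 _+ₚ_ _-ₚ_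
_+ₚ_ : Poly → Poly → Poly
[]       +ₚ q        = q
(a ∷ as) +ₚ []       = a ∷ as
(a ∷ as) +ₚ (b ∷ bs) = (a ℤ.+ b) ∷ (as +ₚ bs)

negₚ : Poly → Poly
negₚ []       = []
negₚ (a ∷ as) = ℤ.- a ∷ negₚ as

_-ₚ_ : Poly → Poly → Poly
p -ₚ q = p +ₚ negₚ q

scale : ℤ → Poly → Poly
scale c []       = []
scale c (a ∷ as) = (c ℤ.* a) ∷ scale c as

infixl 7 _*ₚ_
_*ₚ_ : Poly → Poly → Poly
[]       *ₚ q = []
(a ∷ as) *ₚ q = scale a q +ₚ (+ 0 ∷ (as *ₚ q))

private
  derivFrom : ℕ → Poly → Poly
  derivFrom k []       = []
  derivFrom k (b ∷ bs) = (+ k ℤ.* b) ∷ derivFrom (suc k) bs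

deriv : Poly → Poly
deriv []       = []
deriv (_ ∷ as) = derivFrom 1 as

L : Poly → ℕ
L []       = 0
L (a ∷ as) = ∣ a ∣ ℕ.+ L as

Degree : Poly → ℕ → Set
Degree p n = coeff p n ≢ + 0 × (∀ k → n ℕ.< k → coeff p k ≡ + 0)

DegreeAtLeast1 : Poly → Set
DegreeAtLeast1 p = ∃ λ k → 1 ℕ.≤ k × coeff p k ≢ + 0

infix 4 _∣ₚ_
_∣ₚ_ : Poly → Poly → Set
h ∣ₚ g = ∃ λ q → h *ₚ q ≈ₚ g

SquareFree : Poly → Set
SquareFree g = ∀ h → DegreeAtLeast1 h → ¬ (h *ₚ h ∣ₚ g)

X² : Poly
X² = + 0 ∷ + 0 ∷ + 1 ∷ []

{-# OPTIONS --safe #-}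

-- Take g = f + xⁿ, or g = f + xⁿ + 1 when x² ∣ f, and suppose h² ∣ g with deg h ≥ 1.  Then h has
-- leading coefficient ±1 and divides g′ = n xⁿ⁻¹ + f′.  Over ℂ, n > L(f′) would force every root
-- of h into the open unit disc, so the integer h(0) would vanish.  Without complex numbers: let
-- ℤ[x] act on integer sequences with x as the shift, and let u be a sequence killed by h with
-- u₀ = 1, which exists because h is monic up to sign.  As h ∣ g′, also g′ kills u, that is,
-- n u(k+n−1) = − Σᵢ f′ᵢ u(k+i), so n > L(f′) makes any bound on |u| drop by at least 1 after n − 1
-- steps, and u is eventually 0.  If h(0) ≠ 0 the recurrence given by h can be run backwards, so
-- that u = 0, a contradiction.  Hence x ∣ h and x² ∣ g, which the choice of g excludes.

module Submission where

open import Defs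
open import Data.Nat using (ℕ; _<_)
open import Data.Product using (∃; _×_)
open import Relation.Nullary using (¬_)
open import Relation.Binary.PropositionalEquality using (_≡_)

open import Data.Nat as ℕ using (zero; suc; _≤_; z≤n; s≤s)
import Data.Nat.Properties as ℕ
open import Data.Integer using (ℤ; +_; -[1+_]; -_; _+_; _*_; ∣_∣)
import Data.Integer.Properties as ℤ
open import Data.Integer.Tactic.RingSolver using (solve-∀)
open import Data.List using ([]; _∷_; take; drop)
open import Data.Product using (_,_; proj₁; proj₂)
open import Data.Sum using (_⊎_; inj₁; inj₂)
open import Function using (_∘_)
open import Relation.Nullary using (yes; no; contradiction)
open import Relation.Nullary.Decidable using (_×-dec_)
open import Relation.Binary.PropositionalEquality
  using (_≢_; refl; sym; trans; cong; cong₂; subst; module ≡-Reasoning)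

-- Coefficients and length

coeff-+ₚ : ∀ p q k → coeff (p +ₚ q) k ≡ coeff p k + coeff q k
coeff-+ₚ []      q       k       = sym (ℤ.+-identityˡ _)
coeff-+ₚ (a ∷ p) []      k       = sym (ℤ.+-identityʳ _)
coeff-+ₚ (a ∷ p) (b ∷ q) zero    = refl
coeff-+ₚ (a ∷ p) (b ∷ q) (suc k) = coeff-+ₚ p q k

coeff-negₚ : ∀ p k → coeff (negₚ p) k ≡ - coeff p k
coeff-negₚ []      k       = refl
coeff-negₚ (a ∷ p) zero    = refl
coeff-negₚ (a ∷ p) (suc k) = coeff-negₚ p k

coeff-scale : ∀ c p k → coeff (scale c p) k ≡ c * coeff p k
coeff-scale c []      k       = sym (ℤ.*-zeroʳ c)
coeff-scale c (a ∷ p) zero    = refl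
coeff-scale c (a ∷ p) (suc k) = coeff-scale c p k

coeff-∷-*ₚ : ∀ a p q k → coeff ((a ∷ p) *ₚ q) k ≡ a * coeff q k + coeff (+ 0 ∷ p *ₚ q) k
coeff-∷-*ₚ a p q k =
  trans (coeff-+ₚ (scale a q) (+ 0 ∷ p *ₚ q) k) (cong (_+ _) (coeff-scale a q k))

coeff-*ₚ-zero : ∀ p q → coeff (p *ₚ q) 0 ≡ coeff p 0 * coeff q 0
coeff-*ₚ-zero []      q = refl
coeff-*ₚ-zero (a ∷ p) q = trans (coeff-∷-*ₚ a p q 0) (ℤ.+-identityʳ _)

coeff-*ₚ-one : ∀ p q → coeff (p *ₚ q) 1 ≡ coeff p 0 * coeff q 1 + coeff p 1 * coeff q 0
coeff-*ₚ-one []      q = refl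
coeff-*ₚ-one (a ∷ p) q =
  trans (coeff-∷-*ₚ a p q 1) (cong (_+_ (a * coeff q 1)) (coeff-*ₚ-zero p q))

*ₚ-≈0 : ∀ p q → p ≈ₚ [] → p *ₚ q ≈ₚ []
*ₚ-≈0 []      q p≈0 k = refl
*ₚ-≈0 (a ∷ p) q p≈0 k = trans (coeff-∷-*ₚ a p q k)
  (cong₂ _+_ (trans (cong (_* _) (p≈0 0)) (ℤ.*-zeroˡ (coeff q k))) (shifted k))
  where
  shifted : + 0 ∷ p *ₚ q ≈ₚ []
  shifted zero    = refl
  shifted (suc j) = *ₚ-≈0 p q (p≈0 ∘ suc) j

*ₚ-≈0ʳ : ∀ p q → q ≈ₚ [] → p *ₚ q ≈ₚ []
*ₚ-≈0ʳ []      q q≈0 k = refl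
*ₚ-≈0ʳ (a ∷ p) q q≈0 k = trans (coeff-∷-*ₚ a p q k)
  (cong₂ _+_ (trans (cong (a *_) (q≈0 k)) (ℤ.*-zeroʳ a)) (shifted k))
  where
  shifted : + 0 ∷ p *ₚ q ≈ₚ []
  shifted zero    = refl
  shifted (suc j) = *ₚ-≈0ʳ p q q≈0 j

-- Degrees, leading coefficients and square divisors

VanishesAbove : ℕ → Poly → Set
VanishesAbove m p = ∀ k → m < k → coeff p k ≡ + 0

-- Induction on `m`: for `a + x p`, the summand `a q` has no coefficients beyond `e`, so from there
-- on the product is `p q` shifted by one. The top coefficients may be zero here, and both claims
-- are carried through one induction.
*ₚ-top : ∀ m e p q → VanishesAbove m p → VanishesAbove e q →
  coeff (p *ₚ q) (m ℕ.+ e) ≡ coeff p m * coeff q e × VanishesAbove (m ℕ.+ e) (p *ₚ q)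
*ₚ-top m e [] q p↓ q↓ = refl , λ _ _ → refl
*ₚ-top zero e (a ∷ p) q p↓ q↓ = constant e , λ k e<k →
  trans (constant k) (trans (cong (a *_) (q↓ k e<k)) (ℤ.*-zeroʳ a))
  where
  tail : + 0 ∷ p *ₚ q ≈ₚ []
  tail zero    = refl
  tail (suc k) = *ₚ-≈0 p q (λ j → p↓ (suc j) (s≤s z≤n)) k
  constant : ∀ k → coeff ((a ∷ p) *ₚ q) k ≡ a * coeff q k
  constant k = trans (coeff-∷-*ₚ a p q k) (trans (cong (_+_ (a * coeff q k)) (tail k)) (ℤ.+-identityʳ _))
*ₚ-top (suc m) e (a ∷ p) q p↓ q↓ =
  trans (shift (m ℕ.+ e) (s≤s (ℕ.m≤n+m e m))) (proj₁ ih) , above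
  where
  ih = *ₚ-top m e p q (λ k m<k → p↓ (suc k) (s≤s m<k)) q↓
  shift : ∀ k → e < suc k → coeff ((a ∷ p) *ₚ q) (suc k) ≡ coeff (p *ₚ q) k
  shift k e<k = trans (coeff-∷-*ₚ a p q (suc k))
    (trans (cong (_+ coeff (p *ₚ q) k) (trans (cong (a *_) (q↓ (suc k) e<k)) (ℤ.*-zeroʳ a)))
           (ℤ.+-identityˡ _))
  above : VanishesAbove (suc m ℕ.+ e) ((a ∷ p) *ₚ q)
  above (suc k) (s≤s m+e<k) =
    trans (shift k (s≤s (ℕ.≤-trans (ℕ.m≤n+m e m) (ℕ.<⇒≤ m+e<k)))) (proj₂ ih k m+e<k)

-- Trailing zeros are allowed, so the degree is not the length of the list; it is found by testing
-- the coefficients from the top down.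
zero-or-degree : ∀ p → p ≈ₚ [] ⊎ ∃ (Degree p)
zero-or-degree [] = inj₁ λ _ → refl
zero-or-degree (a ∷ p) with zero-or-degree p
... | inj₂ (m , lead , p↓) = inj₂ (suc m , lead , λ { (suc k) (s≤s m<k) → p↓ k m<k })
... | inj₁ p≈0 with a ℤ.≟ + 0
...   | yes a≡0 = inj₁ λ { zero → a≡0 ; (suc k) → p≈0 k }
...   | no  a≢0 = inj₂ (0 , a≢0 , λ { (suc k) _ → p≈0 k })

degree-unique : ∀ p {m n} → Degree p m → Degree p n → m ≡ n
degree-unique p {m} {n} (lead-m , p↓m) (lead-n , p↓n) = ℕ.≤-antisym
  (ℕ.≮⇒≥ λ n<m → lead-m (p↓n m n<m)) (ℕ.≮⇒≥ λ m<n → lead-n (p↓m n m<n))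

*-≢0 : ∀ i j → i ≢ + 0 → j ≢ + 0 → i * j ≢ + 0
*-≢0 i j i≢0 j≢0 ij≡0 with ℤ.i*j≡0⇒i≡0∨j≡0 i ij≡0
... | inj₁ i≡0 = i≢0 i≡0
... | inj₂ j≡0 = j≢0 j≡0

*ₚ-degree : ∀ p q {m e} → Degree p m → Degree q e → Degree (p *ₚ q) (m ℕ.+ e)
*ₚ-degree p q {m} {e} (lead-p , p↓) (lead-q , q↓) with *ₚ-top m e p q p↓ q↓
... | top , above = (λ eq → *-≢0 _ _ lead-p lead-q (trans (sym top) eq)) , above

Degree-resp-≈ₚ : ∀ p q {n} → p ≈ₚ q → Degree p n → Degree q n
Degree-resp-≈ₚ p q p≈q (lead , p↓) =
  (λ eq → lead (trans (p≈q _) eq)) , λ k n<k → trans (sym (p≈q k)) (p↓ k n<k)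

-- Natural numbers with product 1 are 1. Recording `a = ±1` as `a * a ≡ + 1` makes `a` its own
-- inverse without a case split on the sign later.
square-of-unit : ∀ a b → a * a * b ≡ + 1 → a * a ≡ + 1
square-of-unit a b aab≡1 = unit a (ℕ.m*n≡1⇒m≡1 ∣ a ∣ ∣ a ∣ ∣a∣²≡1)
  where
  ∣a∣²≡1 : ∣ a ∣ ℕ.* ∣ a ∣ ≡ 1
  ∣a∣²≡1 = trans (sym (ℤ.abs-* a a))
    (ℕ.m*n≡1⇒m≡1 ∣ a * a ∣ ∣ b ∣ (trans (sym (ℤ.abs-* (a * a) b)) (cong ∣_∣ aab≡1)))
  unit : ∀ a → ∣ a ∣ ≡ 1 → a * a ≡ + 1
  unit (+ 1)    refl = refl
  unit -[1+ 0 ] refl = refl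

-- In `h² q = g` the degrees add up to `n`, and the leading coefficient 1 of `g` is the square of
-- that of `h` times that of `q`.
square-divisor : ∀ g n h → Degree g n → coeff g n ≡ + 1 → DegreeAtLeast1 h → h *ₚ h ∣ₚ g →
  2 ≤ n × ∃ λ m → VanishesAbove (suc m) h × coeff h (suc m) * coeff h (suc m) ≡ + 1
square-divisor g n h deg-g lead-g (k , 1≤k , h-k) (q , hhq≈g) with zero-or-degree h | zero-or-degree q
... | inj₁ h≈0 | _ = contradiction (h≈0 k) h-k
... | inj₂ _ | inj₁ q≈0 =
  contradiction (trans (sym (hhq≈g n)) (*ₚ-≈0ʳ (h *ₚ h) q q≈0 n)) (proj₁ deg-g)
... | inj₂ (zero , lead , h↓) | inj₂ _ = contradiction (h↓ k 1≤k) h-k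
... | inj₂ (suc m , deg-h) | inj₂ (e , deg-q) =
  subst (2 ≤_) deg≡n (s≤s (ℕ.≤-trans (s≤s z≤n) (ℕ.≤-trans (ℕ.m≤n+m (suc m) m) (ℕ.m≤m+n _ e)))) ,
  m , proj₂ deg-h , square-of-unit (coeff h (suc m)) (coeff q e) lead
  where
  deg-hh : Degree (h *ₚ h) (suc m ℕ.+ suc m)
  deg-hh = *ₚ-degree h h deg-h deg-h
  deg≡n : suc m ℕ.+ suc m ℕ.+ e ≡ n
  deg≡n = degree-unique g
    (Degree-resp-≈ₚ (h *ₚ h *ₚ q) g hhq≈g (*ₚ-degree (h *ₚ h) q deg-hh deg-q)) deg-g
  lead : coeff h (suc m) * coeff h (suc m) * coeff q e ≡ + 1
  lead = begin
    coeff h (suc m) * coeff h (suc m) * coeff q e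
      ≡⟨ cong (_* coeff q e) (sym (proj₁ (*ₚ-top (suc m) (suc m) h h (proj₂ deg-h) (proj₂ deg-h)))) ⟩
    coeff (h *ₚ h) (suc m ℕ.+ suc m) * coeff q e
      ≡⟨ sym (proj₁ (*ₚ-top (suc m ℕ.+ suc m) e (h *ₚ h) q (proj₂ deg-hh) (proj₂ deg-q))) ⟩
    coeff (h *ₚ h *ₚ q) (suc m ℕ.+ suc m ℕ.+ e)
      ≡⟨ hhq≈g _ ⟩
    coeff g (suc m ℕ.+ suc m ℕ.+ e)
      ≡⟨ cong (coeff g) deg≡n ⟩
    coeff g n
      ≡⟨ lead-g ⟩
    + 1 ∎
    where open ≡-Reasoning

-- Length

L-≈0 : ∀ p → p ≈ₚ [] → L p ≡ 0
L-≈0 []      p≈0 = refl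
L-≈0 (a ∷ p) p≈0 = cong₂ ℕ._+_ (cong ∣_∣ (p≈0 0)) (L-≈0 p (p≈0 ∘ suc))

L-cong : ∀ p q → p ≈ₚ q → L p ≡ L q
L-cong []      q       p≈q = sym (L-≈0 q (sym ∘ p≈q))
L-cong (a ∷ p) []      p≈q = L-≈0 (a ∷ p) p≈q
L-cong (a ∷ p) (b ∷ q) p≈q = cong₂ ℕ._+_ (cong ∣_∣ (p≈q 0)) (L-cong p q (p≈q ∘ suc))

L-negₚ : ∀ p → L (negₚ p) ≡ L p
L-negₚ []      = refl
L-negₚ (a ∷ p) = cong₂ ℕ._+_ (ℤ.∣-i∣≡∣i∣ a) (L-negₚ p)

∣coeff∣≤L : ∀ p k → ∣ coeff p k ∣ ≤ L p
∣coeff∣≤L []      k       = z≤n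
∣coeff∣≤L (a ∷ p) zero    = ℕ.m≤m+n _ _
∣coeff∣≤L (a ∷ p) (suc k) = ℕ.≤-trans (∣coeff∣≤L p k) (ℕ.m≤n+m _ _)

L-sub-add : ∀ p q → L (p -ₚ (p +ₚ q)) ≡ L q
L-sub-add p q = trans (L-cong (p -ₚ (p +ₚ q)) (negₚ q) eq) (L-negₚ q)
  where
  cancel : ∀ a b → a + - (a + b) ≡ - b
  cancel = solve-∀
  eq : p -ₚ (p +ₚ q) ≈ₚ negₚ q
  eq k rewrite coeff-+ₚ p (negₚ (p +ₚ q)) k | coeff-negₚ (p +ₚ q) k | coeff-+ₚ p q k
             | coeff-negₚ q k = cancel (coeff p k) (coeff q k)

-- Derivatives

-- A nameable form of the auxiliary function in `deriv`; `k` is the factor for the head coefficient.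
rising : ℕ → Poly → Poly
rising k []       = []
rising k (b ∷ bs) = (+ k * b) ∷ rising (suc k) bs

rising-unique : (F : ℕ → Poly → Poly) → (∀ k → F k [] ≡ []) →
  (∀ k b bs → F k (b ∷ bs) ≡ (+ k * b) ∷ F (suc k) bs) → ∀ k p → F k p ≡ rising k p
rising-unique F F[] F∷ k []       = F[] k
rising-unique F F[] F∷ k (b ∷ bs) =
  trans (F∷ k b bs) (cong (_ ∷_) (rising-unique F F[] F∷ (suc k) bs))

-- The auxiliary function behind deriv is private to Defs and cannot be named.  Abstracting the
-- literal 1 turns deriv (a ∷ as) into that function applied to two variables, from which
-- unification finds the function itself.
mutual
  derivFrom′ : ℕ → Poly → Poly
  derivFrom′ = _

  deriv-∷ : ∀ a as → deriv (a ∷ as) ≡ rising 1 as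
  deriv-∷ a as with 1
  ... | k = rising-unique derivFrom′ (λ _ → refl) (λ _ _ _ → refl) k as

coeff-rising : ∀ k p j → coeff (rising k p) j ≡ + (k ℕ.+ j) * coeff p j
coeff-rising k []       j = sym (ℤ.*-zeroʳ (+ (k ℕ.+ j)))
coeff-rising k (b ∷ bs) zero    rewrite ℕ.+-identityʳ k = refl
coeff-rising k (b ∷ bs) (suc j) rewrite ℕ.+-suc k j = coeff-rising (suc k) bs j

coeff-deriv : ∀ p k → coeff (deriv p) k ≡ + suc k * coeff p (suc k)
coeff-deriv []       k = sym (ℤ.*-zeroʳ (+ suc k))
coeff-deriv (a ∷ as) k rewrite deriv-∷ a as = coeff-rising 1 as k

deriv-+ₚ : ∀ p q → deriv (p +ₚ q) ≈ₚ deriv p +ₚ deriv q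
deriv-+ₚ p q k
  rewrite coeff-+ₚ (deriv p) (deriv q) k | coeff-deriv p k | coeff-deriv q k
        | coeff-deriv (p +ₚ q) k | coeff-+ₚ p q (suc k) =
  ℤ.*-distribˡ-+ (+ suc k) (coeff p (suc k)) (coeff q (suc k))

-- The product rule for a + x p.
deriv-∷-≈ : ∀ a p → deriv (a ∷ p) ≈ₚ p +ₚ (+ 0 ∷ deriv p)
deriv-∷-≈ a p zero
  rewrite coeff-+ₚ p (+ 0 ∷ deriv p) 0 | coeff-deriv (a ∷ p) 0 =
  trans (ℤ.*-identityˡ (coeff p 0)) (sym (ℤ.+-identityʳ _))
deriv-∷-≈ a p (suc k)
  rewrite coeff-+ₚ p (+ 0 ∷ deriv p) (suc k) | coeff-deriv (a ∷ p) (suc k) | coeff-deriv p k =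
  ℤ.suc-* (+ suc k) (coeff p (suc k))

-- The top coefficient of `f′` is `d` times a nonzero integer. Hence `n > L(f′)` forces `n > d`, and
-- adding `xⁿ` gives a monic polynomial of degree `n`.
degree≤L-deriv : ∀ f d → Degree f d → d ≤ L (deriv f)
degree≤L-deriv f zero    _          = z≤n
degree≤L-deriv f (suc d) (lead , _) = begin
  suc d                                 ≡⟨ ℕ.*-identityʳ (suc d) ⟨
  suc d ℕ.* 1                           ≤⟨ ℕ.*-monoʳ-≤ (suc d) (ℕ.n≢0⇒n>0 (lead ∘ ℤ.∣i∣≡0⇒i≡0)) ⟩
  suc d ℕ.* ∣ coeff f (suc d) ∣         ≡⟨ ℤ.abs-* (+ suc d) (coeff f (suc d)) ⟨
  ∣ + suc d * coeff f (suc d) ∣         ≡⟨ cong ∣_∣ (coeff-deriv f d) ⟨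
  ∣ coeff (deriv f) d ∣                 ≤⟨ ∣coeff∣≤L (deriv f) d ⟩
  L (deriv f)                           ∎
  where open ℕ.≤-Reasoning

-- The shift action of ℤ[x] on integer sequences

-- The value at `k` is the sum of `pᵢ u(k+i)`, so a sequence is killed by `p` when it satisfies the
-- linear recurrence with coefficients `p`.
act : Poly → (ℕ → ℤ) → ℕ → ℤ
act []       u k = + 0
act (a ∷ as) u k = a * u k + act as u (suc k)

act-≈0 : ∀ p u k → p ≈ₚ [] → act p u k ≡ + 0
act-≈0 []      u k p≈0 = refl
act-≈0 (a ∷ p) u k p≈0 =
  cong₂ _+_ (trans (cong (_* u k) (p≈0 0)) (ℤ.*-zeroˡ (u k))) (act-≈0 p u (suc k) (p≈0 ∘ suc))

act-≈ₚ : ∀ p q u k → p ≈ₚ q → act p u k ≡ act q u k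
act-≈ₚ []      q       u k p≈q = sym (act-≈0 q u k (sym ∘ p≈q))
act-≈ₚ (a ∷ p) []      u k p≈q = act-≈0 (a ∷ p) u k p≈q
act-≈ₚ (a ∷ p) (b ∷ q) u k p≈q =
  cong₂ _+_ (cong (_* u k) (p≈q 0)) (act-≈ₚ p q u (suc k) (p≈q ∘ suc))

act-cong : ∀ p {u v} → (∀ j → u j ≡ v j) → ∀ k → act p u k ≡ act p v k
act-cong []      u≗v k = refl
act-cong (a ∷ p) u≗v k = cong₂ _+_ (cong (a *_) (u≗v k)) (act-cong p u≗v (suc k))

act-vanishing : ∀ p u k → (∀ j → k ≤ j → u j ≡ + 0) → act p u k ≡ + 0
act-vanishing []      u k u≡0 = refl
act-vanishing (a ∷ p) u k u≡0 = cong₂ _+_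
  (trans (cong (a *_) (u≡0 k ℕ.≤-refl)) (ℤ.*-zeroʳ a))
  (act-vanishing p u (suc k) λ j k<j → u≡0 j (ℕ.<⇒≤ k<j))

act-+ₚ : ∀ p q u k → act (p +ₚ q) u k ≡ act p u k + act q u k
act-+ₚ []      q       u k = sym (ℤ.+-identityˡ _)
act-+ₚ (a ∷ p) []      u k = sym (ℤ.+-identityʳ _)
act-+ₚ (a ∷ p) (b ∷ q) u k =
  trans (cong (_+_ ((a + b) * u k)) (act-+ₚ p q u (suc k))) (regroup a b (u k) _ _)
  where
  regroup : ∀ a b x y z → (a + b) * x + (y + z) ≡ (a * x + y) + (b * x + z)
  regroup = solve-∀

act-scale : ∀ c p u k → act (scale c p) u k ≡ c * act p u k
act-scale c []      u k = sym (ℤ.*-zeroʳ c)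
act-scale c (a ∷ p) u k =
  trans (cong (_+_ (c * a * u k)) (act-scale c p u (suc k))) (regroup c a (u k) _)
  where
  regroup : ∀ c a x y → c * a * x + c * y ≡ c * (a * x + y)
  regroup = solve-∀

act-*ₚ : ∀ p q u k → act (p *ₚ q) u k ≡ act p (act q u) k
act-*ₚ []      q u k = refl
act-*ₚ (a ∷ p) q u k = trans (act-+ₚ (scale a q) (+ 0 ∷ p *ₚ q) u k)
  (cong₂ _+_ (act-scale a q u k)
             (trans (ℤ.+-identityˡ _) (act-*ₚ p q u (suc k))))

act-linear : ∀ p c u v k → act p (λ j → c * u j + v j) k ≡ c * act p u k + act p v k
act-linear []      c u v k = sym (trans (ℤ.+-identityʳ _) (ℤ.*-zeroʳ c))
act-linear (a ∷ p) c u v k =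
  trans (cong (_+_ (a * (c * u k + v k))) (act-linear p c u v (suc k)))
        (regroup a c (u k) (v k) _ _)
  where
  regroup : ∀ a c x y z w → a * (c * x + y) + (c * z + w) ≡ c * (a * x + z) + (a * y + w)
  regroup = solve-∀

act-shift : ∀ p u k → act p (u ∘ suc) k ≡ act p u (suc k)
act-shift []      u k = refl
act-shift (a ∷ p) u k = cong (_+_ (a * u (suc k))) (act-shift p u (suc k))

-- Both operators are polynomials in the same shift. Linearity of the action of `q` and its
-- commuting with the shift carry the induction on `p`.
act-comm : ∀ p q u k → act p (act q u) k ≡ act q (act p u) k
act-comm []      q u k = sym (act-vanishing q _ k λ _ _ → refl)
act-comm (a ∷ p) q u k = begin
  a * act q u k + act p (act q u) (suc k)
    ≡⟨ cong (_+_ (a * act q u k)) (trans (act-comm p q u (suc k)) (sym (act-shift q (act p u) k))) ⟩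
  a * act q u k + act q (act p u ∘ suc) k
    ≡⟨ act-linear q a u (act p u ∘ suc) k ⟨
  act q (act (a ∷ p) u) k ∎
  where open ≡-Reasoning

-- With the shift S this operator satisfies S D − D S = 1, so the commutator with D differentiates
-- polynomials in S.
D : (ℕ → ℤ) → ℕ → ℤ
D v zero    = + 0
D v (suc k) = + suc k * v k

-- Linearity of `D` combined with the relation `S D = D S + 1` applied to `v`.
D-linear-shift : ∀ a u v k → D (λ j → a * u j + v (suc j)) k + v k ≡ a * D u k + D v (suc k)
D-linear-shift a u v zero    = base a (v 0)
  where
  base : ∀ a y → + 0 + y ≡ a * + 0 + + 1 * y
  base = solve-∀
D-linear-shift a u v (suc k) = trans (step (+ suc k) a (u k) (v (suc k)))
  (cong (_+_ (a * (+ suc k * u k))) (sym (ℤ.suc-* (+ suc k) (v (suc k)))))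
  where
  step : ∀ s a x y → s * (a * x + y) + y ≡ a * (s * x) + (y + s * y)
  step = solve-∀

D-zero : ∀ v k → (∀ j → v j ≡ + 0) → D v k ≡ + 0
D-zero v zero    v≡0 = refl
D-zero v (suc k) v≡0 = trans (cong (+ suc k *_) (v≡0 k)) (ℤ.*-zeroʳ (+ suc k))

-- Induction on `p`: moving `D` past the extra shift in `a + S p` leaves one more copy of `p`, which
-- is the term `p` in the product rule `(a + x p)′ = p + x p′`.
act-D : ∀ p u k → act p (D u) k ≡ D (act p u) k + act (deriv p) u k
act-D []      u zero    = refl
act-D []      u (suc k) = sym (trans (ℤ.+-identityʳ _) (ℤ.*-zeroʳ (+ suc k)))
act-D (a ∷ p) u k = begin
  a * D u k + act p (D u) (suc k)
    ≡⟨ cong (_+_ (a * D u k)) (act-D p u (suc k)) ⟩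
  a * D u k + (D (act p u) (suc k) + act (deriv p) u (suc k))
    ≡⟨ ℤ.+-assoc (a * D u k) _ _ ⟨
  a * D u k + D (act p u) (suc k) + act (deriv p) u (suc k)
    ≡⟨ cong (_+ act (deriv p) u (suc k)) (D-linear-shift a u (act p u) k) ⟨
  D (act (a ∷ p) u) k + act p u k + act (deriv p) u (suc k)
    ≡⟨ ℤ.+-assoc (D (act (a ∷ p) u) k) _ _ ⟩
  D (act (a ∷ p) u) k + (act p u k + act (deriv p) u (suc k))
    ≡⟨ cong (λ z → D (act (a ∷ p) u) k + (act p u k + z)) (ℤ.+-identityˡ _) ⟨
  D (act (a ∷ p) u) k + (act p u k + act (+ 0 ∷ deriv p) u k)
    ≡⟨ cong (_+_ (D (act (a ∷ p) u) k)) (act-+ₚ p (+ 0 ∷ deriv p) u k) ⟨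
  D (act (a ∷ p) u) k + act (p +ₚ (+ 0 ∷ deriv p)) u k
    ≡⟨ cong (_+_ (D (act (a ∷ p) u) k))
            (act-≈ₚ (deriv (a ∷ p)) (p +ₚ (+ 0 ∷ deriv p)) u k (deriv-∷-≈ a p)) ⟨
  D (act (a ∷ p) u) k + act (deriv (a ∷ p)) u k ∎
  where open ≡-Reasoning

-- Annihilated sequences

Kills : Poly → (ℕ → ℤ) → Set
Kills p u = ∀ k → act p u k ≡ + 0

kills-multiple : ∀ p q u → Kills p u → Kills p (act q u)
kills-multiple p q u pu≡0 k =
  trans (act-comm p q u k) (act-vanishing q (act p u) k λ j _ → pu≡0 j)

-- `g (D u)` is computed in two ways. As `g u = 0`, the commutator formula gives `g′ u`. As
-- `g = h h q` and `h (D u) = h′ u`, which `h` kills, it gives 0. No product rule for `h² q` is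
-- required.
kills-deriv : ∀ g h u → h *ₚ h ∣ₚ g → Kills h u → Kills (deriv g) u
kills-deriv g h u (q , hhq≈g) hu≡0 k = begin
  act (deriv g) u k                    ≡⟨ ℤ.+-identityˡ _ ⟨
  + 0 + act (deriv g) u k              ≡⟨ cong (_+ act (deriv g) u k) (D-zero (act g u) k gu≡0) ⟨
  D (act g u) k + act (deriv g) u k    ≡⟨ act-D g u k ⟨
  act g (D u) k                        ≡⟨ as-product (D u) k ⟩
  act h (act h (act q (D u))) k        ≡⟨ act-cong h (act-comm h q (D u)) k ⟩
  act h (act q (act h (D u))) k        ≡⟨ kills-multiple h q (act h (D u)) hhDu≡0 k ⟩
  + 0                                  ∎
  where
  open ≡-Reasoning
  as-product : ∀ v j → act g v j ≡ act h (act h (act q v)) j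
  as-product v j = trans (sym (act-≈ₚ (h *ₚ h *ₚ q) g v j hhq≈g))
    (trans (act-*ₚ (h *ₚ h) q v j) (act-*ₚ h h (act q v) j))
  gu≡0 : Kills g u
  gu≡0 j = trans (as-product u j)
    (act-vanishing h _ j λ i _ → kills-multiple h q u hu≡0 i)
  hDu : ∀ j → act h (D u) j ≡ act (deriv h) u j
  hDu j = trans (act-D h u j)
    (trans (cong (_+ act (deriv h) u j) (D-zero (act h u) j hu≡0)) (ℤ.+-identityˡ _))
  hhDu≡0 : Kills h (act h (D u))
  hhDu≡0 j = trans (act-cong h hDu j) (kills-multiple h (deriv h) u hu≡0 j)

-- A nonzero sequence killed by a polynomial with leading coefficient ±1

act-split : ∀ m p u k → VanishesAbove m p →
  act p u k ≡ act (take m p) u k + coeff p m * u (k ℕ.+ m)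
act-split zero    []      u k p↓ = refl
act-split zero    (a ∷ p) u k p↓ rewrite ℕ.+-identityʳ k =
  trans (cong (_+_ (a * u k)) (act-≈0 p u (suc k) λ j → p↓ (suc j) (s≤s z≤n)))
        (ℤ.+-comm (a * u k) (+ 0))
act-split (suc m) []      u k p↓ = refl
act-split (suc m) (a ∷ p) u k p↓ rewrite ℕ.+-suc k m =
  trans (cong (_+_ (a * u k)) (act-split m p u (suc k) λ j m<j → p↓ (suc j) (s≤s m<j)))
        (sym (ℤ.+-assoc (a * u k) _ _))

-- The truncated polynomial reads only `m` consecutive values, so it can be evaluated on a finite
-- window in place of the whole sequence.
act-take-local : ∀ m p u v k l → (∀ j → j < m → u (k ℕ.+ j) ≡ v (l ℕ.+ j)) →
  act (take m p) u k ≡ act (take m p) v l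
act-take-local zero    p       u v k l u≗v = refl
act-take-local (suc m) []      u v k l u≗v = refl
act-take-local (suc m) (a ∷ p) u v k l u≗v = cong₂ _+_ (cong (a *_) here)
  (act-take-local m p u v (suc k) (suc l) there)
  where
  here : u k ≡ v l
  here with u≗v 0 (s≤s z≤n)
  ... | eq rewrite ℕ.+-identityʳ k | ℕ.+-identityʳ l = eq
  there : ∀ j → j < m → u (suc k ℕ.+ j) ≡ v (suc l ℕ.+ j)
  there j j<m with u≗v (suc j) (s≤s j<m)
  ... | eq rewrite ℕ.+-suc k j | ℕ.+-suc l j = eq

-- Iteration of the companion matrix of `h`: the state holds `suc m` consecutive values, and the
-- next one is solved from the recurrence. Since `a * a ≡ + 1`, dividing by `a` is multiplying by
-- it, so the values stay integral.
module Companion (m : ℕ) (h : Poly) (h↓ : VanishesAbove (suc m) h)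
                 (unit : coeff h (suc m) * coeff h (suc m) ≡ + 1) where

  private
    a : ℤ
    a = coeff h (suc m)

  -- Only the entries 0, …, m of a window are meaningful.
  step : (ℕ → ℤ) → ℕ → ℤ
  step w j with j ℕ.<? m
  ... | yes _ = w (suc j)
  ... | no  _ = - a * act (take (suc m) h) w 0

  -- The initial window of ones makes `seq 0` equal to 1, so `seq` is not the zero sequence.
  window : ℕ → ℕ → ℤ
  window zero    = λ _ → + 1
  window (suc k) = step (window k)

  seq : ℕ → ℤ
  seq k = window k 0

  step-inside : ∀ w j → j < m → step w j ≡ w (suc j)
  step-inside w j j<m with j ℕ.<? m
  ... | yes _   = refl
  ... | no  j≮m = contradiction j<m j≮m

  step-last : ∀ w → step w m ≡ - a * act (take (suc m) h) w 0
  step-last w with m ℕ.<? m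
  ... | yes m<m = contradiction m<m (ℕ.<-irrefl refl)
  ... | no  _   = refl

  -- Consecutive windows overlap: entry `suc j` of one is entry `j` of the next, until it reaches
  -- the head.
  window≡seq : ∀ k j → j ≤ m → window k j ≡ seq (k ℕ.+ j)
  window≡seq k zero    _   = cong seq (sym (ℕ.+-identityʳ k))
  window≡seq k (suc j) j<m = begin
    window k (suc j)   ≡⟨ step-inside (window k) j j<m ⟨
    window (suc k) j   ≡⟨ window≡seq (suc k) j (ℕ.<⇒≤ j<m) ⟩
    seq (suc k ℕ.+ j)  ≡⟨ cong seq (ℕ.+-suc k j) ⟨
    seq (k ℕ.+ suc j)  ∎
    where open ≡-Reasoning

  killed : Kills h seq
  killed k = begin
    act h seq k
      ≡⟨ act-split (suc m) h seq k h↓ ⟩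
    act (take (suc m) h) seq k + a * seq (k ℕ.+ suc m)
      ≡⟨ cong₂ (λ x y → x + a * y) lower upper ⟩
    A + a * (- a * A)
      ≡⟨ regroup a A ⟩
    A + - (a * a * A)
      ≡⟨ cong (λ c → A + - (c * A)) unit ⟩
    A + - (+ 1 * A)
      ≡⟨ cancel A ⟩
    + 0 ∎
    where
    open ≡-Reasoning
    A = act (take (suc m) h) (window k) 0
    lower : act (take (suc m) h) seq k ≡ A
    lower = act-take-local (suc m) h seq (window k) k 0 λ { j (s≤s j≤m) → sym (window≡seq k j j≤m) }
    upper : seq (k ℕ.+ suc m) ≡ - a * A
    upper = trans (cong seq (ℕ.+-suc k m))
      (trans (sym (window≡seq (suc k) m ℕ.≤-refl)) (step-last (window k)))
    regroup : ∀ a x → x + a * (- a * x) ≡ x + - (a * a * x)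
    regroup = solve-∀
    cancel : ∀ x → x + - (+ 1 * x) ≡ + 0
    cancel = solve-∀

-- Decay of sequences killed by n xⁿ⁻¹ + p with n > L p

-- The triangle inequality. As `p` vanishes from index `N` on, a bound on `N` consecutive values is
-- enough.
act-bound : ∀ N p u k B → (∀ i → N ≤ i → coeff p i ≡ + 0) →
  (∀ i → i < N → ∣ u (k ℕ.+ i) ∣ ≤ B) → ∣ act p u k ∣ ≤ L p ℕ.* B
act-bound N       []      u k B p↓ u≤B = z≤n
act-bound zero    (a ∷ p) u k B p↓ u≤B
  rewrite act-≈0 (a ∷ p) u k (λ i → p↓ i z≤n) = z≤n
act-bound (suc N) (a ∷ p) u k B p↓ u≤B = begin
  ∣ a * u k + act p u (suc k) ∣          ≤⟨ ℤ.∣i+j∣≤∣i∣+∣j∣ (a * u k) _ ⟩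
  ∣ a * u k ∣ ℕ.+ ∣ act p u (suc k) ∣    ≡⟨ cong (ℕ._+ _) (ℤ.abs-* a (u k)) ⟩
  ∣ a ∣ ℕ.* ∣ u k ∣ ℕ.+ ∣ act p u (suc k) ∣
    ≤⟨ ℕ.+-mono-≤ (ℕ.*-monoʳ-≤ ∣ a ∣ here)
         (act-bound N p u (suc k) B (λ i N≤i → p↓ (suc i) (s≤s N≤i)) there) ⟩
  ∣ a ∣ ℕ.* B ℕ.+ L p ℕ.* B              ≡⟨ ℕ.*-distribʳ-+ B ∣ a ∣ (L p) ⟨
  (∣ a ∣ ℕ.+ L p) ℕ.* B                  ∎
  where
  open ℕ.≤-Reasoning
  here : ∣ u k ∣ ≤ B
  here with u≤B 0 (s≤s z≤n)
  ... | u≤B₀ rewrite ℕ.+-identityʳ k = u≤B₀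
  there : ∀ i → i < N → ∣ u (suc k ℕ.+ i) ∣ ≤ B
  there i i<N with u≤B (suc i) (s≤s i<N)
  ... | u≤Bᵢ rewrite ℕ.+-suc k i = u≤Bᵢ

initial-bound : ∀ (u : ℕ → ℤ) N → ∃ λ B → ∀ i → i < N → ∣ u i ∣ ≤ B
initial-bound u zero    = 0 , λ _ ()
initial-bound u (suc N) with initial-bound u N
... | B , u≤B = B ℕ.+ ∣ u N ∣ , bound
  where
  bound : ∀ i → i < suc N → ∣ u i ∣ ≤ B ℕ.+ ∣ u N ∣
  bound i (s≤s i≤N) with ℕ.m≤n⇒m<n∨m≡n i≤N
  ... | inj₁ i<N  = ℕ.≤-trans (u≤B i i<N) (ℕ.m≤m+n B _)
  ... | inj₂ refl = ℕ.m≤n+m _ B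

-- Here `N` stands for `n − 1` and `p` for `f′`; `rec` is the recurrence given by `g′`.
module Decay (N : ℕ) (p : Poly) (p↓ : ∀ i → N ≤ i → coeff p i ≡ + 0) (L<n : L p < suc N)
             (u : ℕ → ℤ) (rec : ∀ k → act p u k + + suc N * u (k ℕ.+ N) ≡ + 0) where

  next-bound : ∀ k B → (∀ i → i < N → ∣ u (k ℕ.+ i) ∣ ≤ B) →
    suc N ℕ.* ∣ u (k ℕ.+ N) ∣ ≤ L p ℕ.* B
  next-bound k B u≤B = begin
    suc N ℕ.* ∣ u (k ℕ.+ N) ∣    ≡⟨ ℤ.abs-* (+ suc N) (u (k ℕ.+ N)) ⟨
    ∣ y ∣                        ≡⟨ cong ∣_∣ y≡-x ⟩
    ∣ - act p u k ∣              ≡⟨ ℤ.∣-i∣≡∣i∣ (act p u k) ⟩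
    ∣ act p u k ∣                ≤⟨ act-bound N p u k B p↓ u≤B ⟩
    L p ℕ.* B                    ∎
    where
    open ℕ.≤-Reasoning
    y = + suc N * u (k ℕ.+ N)
    isolate : ∀ x y → y ≡ - x + (x + y)
    isolate = solve-∀
    y≡-x : y ≡ - act p u k
    y≡-x = trans (isolate (act p u k) y)
      (trans (cong (_+_ (- act p u k)) (rec k)) (ℤ.+-identityʳ _))

  -- A bound `B` on `N` consecutive values passes to the next one, because
  -- `n |u(k+N)| ≤ L(p) B ≤ n B`.
  bounded : ∃ λ B → ∀ j → ∣ u j ∣ ≤ B
  bounded with initial-bound u N
  ... | B , u≤B = B , λ j → prefix (suc j) j (ℕ.m≤m+n (suc j) N)
    where
    prefix : ∀ k i → i < k ℕ.+ N → ∣ u i ∣ ≤ B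
    prefix zero    i i<N = u≤B i i<N
    prefix (suc k) i (s≤s i≤k+N) with ℕ.m≤n⇒m<n∨m≡n i≤k+N
    ... | inj₁ i<k+N = prefix k i i<k+N
    ... | inj₂ refl  = ℕ.*-cancelˡ-≤ (suc N) (ℕ.≤-trans
      (next-bound k B λ i i<N → prefix k (k ℕ.+ i) (ℕ.+-monoʳ-< k i<N))
      (ℕ.*-monoˡ-≤ B (ℕ.<⇒≤ L<n)))

  -- With `suc B` positive, `L(p) < n` gives `n |u(j)| < n (B + 1)`, and integrality lowers the
  -- bound to `B` at the cost of `N` indices.
  eventually-zero : ∀ B K → (∀ j → K ≤ j → ∣ u j ∣ ≤ B) → ∃ λ K′ → ∀ j → K′ ≤ j → u j ≡ + 0
  eventually-zero zero    K u≤0 = K , λ j K≤j → ℤ.∣i∣≡0⇒i≡0 (ℕ.n≤0⇒n≡0 (u≤0 j K≤j))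
  eventually-zero (suc B) K u≤B = eventually-zero B (K ℕ.+ N) smaller
    where
    smaller : ∀ j → K ℕ.+ N ≤ j → ∣ u j ∣ ≤ B
    smaller j K+N≤j = subst (λ i → ∣ u i ∣ ≤ B) (ℕ.m∸n+n≡m N≤j)
      (ℕ.≤-pred (ℕ.*-cancelˡ-< (suc N) _ _ (ℕ.≤-<-trans
        (next-bound (j ℕ.∸ N) (suc B) λ i _ → u≤B _ (ℕ.≤-trans K≤j∸N (ℕ.m≤m+n _ i)))
        (ℕ.*-monoˡ-< (suc B) L<n))))
      where
      N≤j : N ≤ j
      N≤j = ℕ.≤-trans (ℕ.m≤n+m N K) K+N≤j
      K≤j∸N : K ≤ j ℕ.∸ N
      K≤j∸N = subst (_≤ j ℕ.∸ N) (ℕ.m+n∸n≡m K N) (ℕ.∸-monoˡ-≤ N K+N≤j)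

-- Backward recurrence and the constant term of `h`

vanishes-backwards : ∀ h u → coeff h 0 ≢ + 0 → Kills h u → ∀ K →
  (∀ j → K ≤ j → u j ≡ + 0) → ∀ j → u j ≡ + 0
vanishes-backwards h       u h₀≢0 hu≡0 zero    u≡0 j = u≡0 j z≤n
vanishes-backwards []      u h₀≢0 hu≡0 (suc K) u≡0   = contradiction refl h₀≢0
vanishes-backwards (a ∷ p) u h₀≢0 hu≡0 (suc K) u≡0   =
  vanishes-backwards (a ∷ p) u h₀≢0 hu≡0 K earlier
  where
  -- Beyond `K` everything vanishes, so the recurrence at `K` retains only its lowest term.
  au≡0 : a * u K ≡ + 0
  au≡0 = trans (sym (ℤ.+-identityʳ _))
    (trans (cong (_+_ (a * u K)) (sym (act-vanishing p u (suc K) u≡0))) (hu≡0 K))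
  earlier : ∀ j → K ≤ j → u j ≡ + 0
  earlier j K≤j with ℕ.m≤n⇒m<n∨m≡n K≤j
  ... | inj₁ K<j = u≡0 j K<j
  ... | inj₂ refl with ℤ.i*j≡0⇒i≡0∨j≡0 a au≡0
  ...   | inj₁ a≡0 = contradiction a≡0 h₀≢0
  ...   | inj₂ u≡0 = u≡0

constant-term-zero : ∀ N p h m → (∀ i → N ≤ i → coeff p i ≡ + 0) → L p < suc N →
  VanishesAbove (suc m) h → coeff h (suc m) * coeff h (suc m) ≡ + 1 →
  (∀ u → Kills h u → ∀ k → act p u k + + suc N * u (k ℕ.+ N) ≡ + 0) → coeff h 0 ≡ + 0
constant-term-zero N p h m p↓ L<n h↓ unit rec with coeff h 0 ℤ.≟ + 0
... | yes h₀≡0 = h₀≡0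
-- `seq 0` computes to 1, so its vanishing is absurd.
... | no  h₀≢0 = contradiction (vanishes-backwards h seq h₀≢0 killed K tail 0) λ ()
  where
  open Companion m h h↓ unit
  open Decay N p p↓ L<n seq (rec seq killed)
  zeros = eventually-zero (proj₁ bounded) 0 λ j _ → proj₂ bounded j
  K = proj₁ zeros
  tail = proj₂ zeros

-- The polynomial g = f + c + xⁿ

mono : ℕ → Poly
mono zero    = + 1 ∷ []
mono (suc n) = + 0 ∷ mono n

coeff-mono : ∀ n → coeff (mono n) n ≡ + 1
coeff-mono zero    = refl
coeff-mono (suc n) = coeff-mono n

mono-vanishes : ∀ n → VanishesAbove n (mono n)
mono-vanishes zero    (suc k) _         = refl
mono-vanishes (suc n) (suc k) (s≤s n<k) = mono-vanishes n k n<k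

L-mono : ∀ n → L (mono n) ≡ 1
L-mono zero    = refl
L-mono (suc n) = L-mono n

-- At `i = 1` this is the derivative of `x` to the power `N + 1`; the general `i` serves the
-- induction.
act-rising-mono : ∀ i N u k → act (rising i (mono N)) u k ≡ + (i ℕ.+ N) * u (k ℕ.+ N)
act-rising-mono i zero    u k rewrite ℕ.+-identityʳ i | ℕ.+-identityʳ k =
  trans (ℤ.+-identityʳ _) (cong (_* u k) (ℤ.*-identityʳ (+ i)))
act-rising-mono i (suc N) u k rewrite ℕ.+-suc i N | ℕ.+-suc k N | ℤ.*-zeroʳ (+ i) =
  trans (ℤ.+-identityˡ _) (act-rising-mono (suc i) N u (suc k))

module Perturbed (f : Poly) (d : ℕ) (deg-f : Degree f d) (N : ℕ) (L<n : L (deriv f) < suc N)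
                 (c : ℤ) where

  g : Poly
  g = f +ₚ (c ∷ mono N)

  d<n : d < suc N
  d<n = ℕ.≤-<-trans (degree≤L-deriv f d deg-f) L<n

  leading : coeff g (suc N) ≡ + 1
  leading = trans (coeff-+ₚ f (c ∷ mono N) (suc N))
    (cong₂ _+_ (proj₂ deg-f (suc N) d<n) (coeff-mono N))

  degree : Degree g (suc N)
  degree = (λ g-n → contradiction (trans (sym leading) g-n) λ ()) , above
    where
    above : VanishesAbove (suc N) g
    above (suc k) (s≤s N<k) = trans (coeff-+ₚ f (c ∷ mono N) (suc k))
      (cong₂ _+_ (proj₂ deg-f (suc k) (ℕ.<-trans d<n (s≤s N<k))) (mono-vanishes N k N<k))

  deriv-f-vanishes : ∀ i → N ≤ i → coeff (deriv f) i ≡ + 0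
  deriv-f-vanishes i N≤i = trans (coeff-deriv f i)
    (trans (cong (+ suc i *_) (proj₂ deg-f (suc i) (ℕ.<-≤-trans d<n (s≤s N≤i))))
           (ℤ.*-zeroʳ (+ suc i)))

  act-deriv : ∀ u k → act (deriv g) u k ≡ act (deriv f) u k + + suc N * u (k ℕ.+ N)
  act-deriv u k = begin
    act (deriv g) u k
      ≡⟨ act-≈ₚ (deriv g) (deriv f +ₚ deriv (c ∷ mono N)) u k (deriv-+ₚ f (c ∷ mono N)) ⟩
    act (deriv f +ₚ deriv (c ∷ mono N)) u k
      ≡⟨ act-+ₚ (deriv f) (deriv (c ∷ mono N)) u k ⟩
    act (deriv f) u k + act (deriv (c ∷ mono N)) u k
      ≡⟨ cong (λ e → act (deriv f) u k + act e u k) (deriv-∷ c (mono N)) ⟩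
    act (deriv f) u k + act (rising 1 (mono N)) u k
      ≡⟨ cong (_+_ (act (deriv f) u k)) (act-rising-mono 1 N u k) ⟩
    act (deriv f) u k + + suc N * u (k ℕ.+ N) ∎
    where open ≡-Reasoning

  -- A square divisor `h²` would have `h(0) = 0`, hence `x² ∣ g`, so both lowest coefficients of `g`
  -- would vanish.
  squareFree : ¬ (coeff f 0 + c ≡ + 0 × coeff f 1 ≡ + 0) → SquareFree g
  squareFree not-both h h≥1 hh∣g@(q , hhq≈g) with square-divisor g (suc N) h degree leading h≥1 hh∣g
  ... | s≤s 1≤N , m , h↓ , unit = not-both
    ( trans (sym (coeff-+ₚ f (c ∷ mono N) 0)) g₀≡0
    , trans (sym (trans (coeff-+ₚ f (c ∷ mono N) 1)
                        (trans (cong (_+_ (coeff f 1)) (mono₀ 1≤N)) (ℤ.+-identityʳ _)))) g₁≡0 )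
    where
    -- As `n ≥ 2`, the term `xⁿ` does not reach the coefficient of `x`.
    mono₀ : ∀ {N} → 1 ≤ N → coeff (mono N) 0 ≡ + 0
    mono₀ (s≤s _) = refl
    h₀≡0 : coeff h 0 ≡ + 0
    h₀≡0 = constant-term-zero N (deriv f) h m deriv-f-vanishes L<n h↓ unit
      λ u hu≡0 k → trans (sym (act-deriv u k)) (kills-deriv g h u hh∣g hu≡0 k)
    g₀≡0 : coeff g 0 ≡ + 0
    g₀≡0 rewrite sym (hhq≈g 0) | coeff-*ₚ-zero (h *ₚ h) q | coeff-*ₚ-zero h h | h₀≡0 = refl
    -- The coefficients of 1 and `x` in `h²` are `h₀²` and `2 h₀ h₁`; both contain the factor `h₀`.
    g₁≡0 : coeff g 1 ≡ + 0
    g₁≡0 rewrite sym (hhq≈g 1) | coeff-*ₚ-one (h *ₚ h) q | coeff-*ₚ-zero h h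
               | coeff-*ₚ-one h h | h₀≡0 | ℤ.*-zeroʳ (coeff h 1) = refl

-- Divisibility by `x²` and the choice of `c`

X²-*ₚ : ∀ q → X² *ₚ q ≈ₚ + 0 ∷ + 0 ∷ q
X²-*ₚ q k = trans (coeff-∷-*ₚ (+ 0) (+ 0 ∷ + 1 ∷ []) q k) (trans (ℤ.+-identityˡ _) (outer k))
  where
  inner : ∀ k → coeff (+ 0 ∷ (+ 1 ∷ []) *ₚ q) k ≡ coeff (+ 0 ∷ q) k
  inner zero    = refl
  inner (suc k) = trans (coeff-∷-*ₚ (+ 1) [] q k)
    (trans (cong₂ _+_ (ℤ.*-identityˡ (coeff q k)) (nil k)) (ℤ.+-identityʳ _))
    where
    nil : + 0 ∷ [] ≈ₚ []
    nil zero    = refl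
    nil (suc _) = refl
  outer : ∀ k → coeff (+ 0 ∷ (+ 0 ∷ + 1 ∷ []) *ₚ q) k ≡ coeff (+ 0 ∷ + 0 ∷ q) k
  outer zero    = refl
  outer (suc k) = trans (coeff-∷-*ₚ (+ 0) (+ 1 ∷ []) q k) (trans (ℤ.+-identityˡ _) (inner k))

X²∣⇒ : ∀ f → X² ∣ₚ f → coeff f 0 ≡ + 0 × coeff f 1 ≡ + 0
X²∣⇒ f (q , X²q≈f) =
  trans (sym (X²q≈f 0)) (X²-*ₚ q 0) , trans (sym (X²q≈f 1)) (X²-*ₚ q 1)

X²∣⇐ : ∀ f → coeff f 0 ≡ + 0 × coeff f 1 ≡ + 0 → X² ∣ₚ f
X²∣⇐ f (f₀≡0 , f₁≡0) = drop 2 f , λ k → trans (X²-*ₚ (drop 2 f) k) (restore f f₀≡0 f₁≡0 k)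
  where
  restore : ∀ f → coeff f 0 ≡ + 0 → coeff f 1 ≡ + 0 → + 0 ∷ + 0 ∷ drop 2 f ≈ₚ f
  restore f           f₀≡0 f₁≡0 zero          = sym f₀≡0
  restore f           f₀≡0 f₁≡0 (suc zero)    = sym f₁≡0
  restore []          f₀≡0 f₁≡0 (suc (suc k)) = refl
  restore (_ ∷ [])    f₀≡0 f₁≡0 (suc (suc k)) = refl
  restore (_ ∷ _ ∷ f) f₀≡0 f₁≡0 (suc (suc k)) = refl

theorem1p4 : (f : Poly) (d : ℕ) → Degree f d → (n : ℕ) → L (deriv f) < n →
    ∃ λ g → SquareFree g × Degree g n
    × (¬ (X² ∣ₚ f) → L (f -ₚ g) ≡ 1)
    × (X² ∣ₚ f → L (f -ₚ g) ≡ 2)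
-- The case `n = 0` is excluded by `n > L(f′)`. Whether `x²` divides `f` is decided on the two
-- lowest coefficients.
theorem1p4 f d deg-f (suc N) L<n with (coeff f 0 ℤ.≟ + 0) ×-dec (coeff f 1 ℤ.≟ + 0)
-- With `c = 0` the two lowest coefficients of `f` and `g` agree in the case at issue, so they are
-- not both zero.
... | no ¬x²∣f = g
    , squareFree (λ (f₀+0≡0 , f₁≡0) → ¬x²∣f (trans (sym (ℤ.+-identityʳ _)) f₀+0≡0 , f₁≡0))
    , degree
    , (λ _ → trans (L-sub-add f _) (L-mono N))
    , λ x²∣f → contradiction (X²∣⇒ f x²∣f) ¬x²∣f
  where open Perturbed f d deg-f N L<n (+ 0)
-- Here `f(0) = 0`, and `c = 1` makes the constant term of `f + c` nonzero, which adds 1 to the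
-- length.
... | yes x²∣f = g
    , squareFree (λ (f₀+1≡0 , _) →
        contradiction (trans (sym (cong (_+ + 1) (proj₁ x²∣f))) f₀+1≡0) λ ())
    , degree
    , (λ ¬x²∣f → contradiction (X²∣⇐ f x²∣f) ¬x²∣f)
    , λ _ → trans (L-sub-add f _) (cong suc (L-mono N))
  where open Perturbed f d deg-f N L<n (+ 1)
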